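{- Let $r\ge 2$ and let $K_r$ be the complete graph on $r$ vertices with an arbitrary edge-ordering. Then $sat_m(n,e_0+K_r)=O(1)$.
   Context: An edge-ordered graph is a finite simple graph together with a linear order on its edge set (usually given by an injective labeling $l:E\to\mathbb{N}$ or $l:E\to\mathbb{R}$). An edge-ordered graph $H$ contains $G$ (has a copy of $G$) if $G$ is isomorphic, by an isomorphism respecting the edge-order, to a subgraph of $H$ with the induced order; otherwise $H$ is $G$-free. For an edge-ordered graph $G$, $e_0+G$ denotes the edge-ordered graph obtained from $G$ by adding a vertex-disjoint (isolated) edge $e_0$ whose label is smaller than all labels of $G$. $sat_m(n,G)$ is the minimum number of edges in a $G$-free edge-ordered graph $H$ on $n$ vertices such that adding to $H$ any missing edge, inserted at the beginning of the linear order (i.e. with a label smaller than all labels of $H$), creates a copy of $G$. Asymptotic notation is for $n\to\infty$ with the edge-ordered graph $K_r$ fixed. -}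

module Defs where

open import Data.Fin.Base using (Fin; zero; suc; _<_)
open import Data.List.Base using (List; _∷_; map; length)
open import Data.List.Membership.Propositional using (_∈_; _∉_)
open import Data.List.Relation.Binary.Sublist.Heterogeneous using (Sublist)
open import Data.List.Relation.Unary.All using (All; []; _∷_)
open import Data.List.Relation.Unary.All.Properties using (¬Any⇒All¬)
open import Data.List.Relation.Unary.AllPairs using (_∷_)
open import Data.List.Relation.Unary.Unique.Propositional using (Unique)
open import Data.List.Relation.Unary.Unique.Propositional.Properties using (map⁺)
open import Data.Nat.Base as ℕ using (ℕ; s≤s; z≤n)
open import Data.Product.Base using (_×_; ∃-syntax)
open import Data.Sum.Base using (_⊎_)
open import Function.Definitions using (Injective)
open import Relation.Binary.PropositionalEquality using (_≡_; _≢_; refl)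
open import Relation.Nullary.Negation using (¬_)

-- An unordered pair of distinct vertices, stored with its smaller endpoint
-- first.  The ordering proof is irrelevant, so two edges are equal as soon as
-- they have the same endpoints.
record Edge (n : ℕ) : Set where
  constructor edge
  field
    lo hi   : Fin n
    .lo<hi  : lo < hi

open Edge public

-- A linear order on a finite edge set amounts to a duplicate-free enumeration
-- of it: the edges are listed from the smallest label to the largest.
record EdgeOrderedGraph (n : ℕ) : Set where
  constructor mkGraph
  field
    edges    : List (Edge n)
    distinct : Unique edges

open EdgeOrderedGraph public

size : ∀ {n} → EdgeOrderedGraph n → ℕ
size G = length (edges G)

IsComplete : ∀ {r} → EdgeOrderedGraph r → Set
IsComplete {r} G = (e : Edge r) → e ∈ edges G

-- The vertex map f carries e onto e′; f need not preserve the order of the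
-- vertices, so the two endpoints may be exchanged.
MapsTo : ∀ {k n} → (Fin k → Fin n) → Edge k → Edge n → Set
MapsTo f e e′ = (f (lo e) ≡ lo e′ × f (hi e) ≡ hi e′)
              ⊎ (f (lo e) ≡ hi e′ × f (hi e) ≡ lo e′)

-- A copy of G in H: the images under f of the edges of G, taken in the order
-- of G, form a sublist of the edges of H, that is, a set of edges of H with
-- the order induced from H.
Contains : ∀ {n k} → EdgeOrderedGraph n → EdgeOrderedGraph k → Set
Contains {n} {k} H G =
  ∃[ f ] Injective {A = Fin k} {B = Fin n} _≡_ _≡_ f
       × Sublist (MapsTo f) (edges G) (edges H)

addFirst : ∀ {n} (e : Edge n) (H : EdgeOrderedGraph n) → e ∉ edges H →
           EdgeOrderedGraph n
addFirst e H e∉H = mkGraph (e ∷ edges H) (¬Any⇒All¬ (edges H) e∉H ∷ distinct H)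

shift : ∀ {k} → Edge k → Edge (2 ℕ.+ k)
shift (edge i j i<j) = edge (suc (suc i)) (suc (suc j)) (s≤s (s≤s i<j))

shift-injective : ∀ {k} {e e′ : Edge k} → shift e ≡ shift e′ → e ≡ e′
shift-injective refl = refl

e₀ : ∀ {k} → Edge (2 ℕ.+ k)
e₀ = edge zero (suc zero) (s≤s z≤n)

e₀-fresh : ∀ {k} (es : List (Edge k)) → All (e₀ ≢_) (map shift es)
e₀-fresh List.[]  = []
e₀-fresh (_ ∷ es) = (λ ()) ∷ e₀-fresh es

infix 8 e₀+_

e₀+_ : ∀ {k} → EdgeOrderedGraph k → EdgeOrderedGraph (2 ℕ.+ k)
e₀+ G = mkGraph (e₀ ∷ map shift (edges G))
                (e₀-fresh (edges G) ∷ map⁺ shift-injective (distinct G))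

record IsSaturated {n k} (H : EdgeOrderedGraph n) (G : EdgeOrderedGraph k) : Set where
  field
    free     : ¬ Contains H G
    saturate : ∀ e (e∉H : e ∉ edges H) → Contains (addFirst e H e∉H) G

IsMinimum : (ℕ → Set) → ℕ → Set
IsMinimum P m = P m × (∀ m′ → P m′ → m ℕ.≤ m′)

-- sat_m(n, G) = m, as a relation; at most one m satisfies it.
Satₘ : ∀ {k} → ℕ → EdgeOrderedGraph k → ℕ → Set
Satₘ n G = IsMinimum (λ m → ∃[ H ] IsSaturated {n} H G × size H ≡ m)

{-# OPTIONS --safe #-}
module Submission where

-- Glue three copies of K along a triangle of hubs so that the first edge of each copy is one
-- side of the triangle, and order the edges so that the triangle comes first.  Every r-clique
-- contains two hubs, hence a side of the triangle; an edge preceding the clique would then be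
-- a side too, and two sides always meet, so e₀ + K does not occur.  No vertex lies in all three
-- copies, so adding an edge with an endpoint outside this fixed graph, possibly after further
-- edges inside it, completes a copy of e₀ + K.  It remains to saturate greedily over the
-- boundedly many edges inside.

open import Defs
open import Data.Fin.Base
  using (Fin; zero; suc; _<_; punchIn; punchOut; join; combine; inject≤; splitAt)
open import Data.Fin.Properties as Fin
  using (_≟_; _<?_; <-cmp; <-asym; <⇒≢; any?; all?; punchInᵢ≢i; punchIn-injective;
         punchOut-injective; injective⇒≤; inject≤-injective; splitAt-join; combine-injective)
open import Data.List.Base as List
  using (List; []; _∷_; _++_; map; mapMaybe; length; allFin; cartesianProduct;
         cartesianProductWith)
open import Data.List.Properties using (length-map; length-mapMaybe; map-id)
open import Data.List.Membership.Propositional using (_∈_; _∉_; find; lose)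
open import Data.List.Membership.Propositional.Properties
  using (∈-allFin; ∈-map⁺; ∈-lookup; ∈-map⁻; ∈-cartesianProduct⁺; ∈-cartesianProduct⁻;
         ∈-cartesianProductWith⁺)
import Data.List.Membership.DecPropositional as DecMembership
open import Data.List.Relation.Binary.Sublist.Heterogeneous as Sublist
  using (Sublist; []; _∷_; _∷ʳ_)
import Data.List.Relation.Binary.Sublist.Heterogeneous.Properties as Sublistₚ
open import Data.List.Relation.Binary.Sublist.Propositional
  using (_⊆_; ⊆-refl; ⊆-trans) renaming (lookup to lookup-⊆)
open import Data.List.Relation.Unary.All as All using (All; []; _∷_)
open import Data.List.Relation.Unary.AllPairs as AllPairs using ([]; _∷_)
open import Data.List.Relation.Unary.Any as Any using (Any; here; there)
import Data.List.Relation.Unary.Any.Properties as Anyₚ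
open import Data.List.Relation.Unary.Unique.Propositional using (Unique)
import Data.List.Relation.Unary.Unique.DecPropositional as DecUnique
import Data.List.Relation.Unary.Unique.Propositional.Properties as Uniqueₚ
open import Data.Maybe.Base using (Maybe; just; nothing)
import Data.Maybe.Relation.Unary.Any as Maybe
open import Data.Nat.Base as ℕ using (ℕ; zero; suc; _+_; _*_; _≤_; z≤n; s≤s)
open import Data.Nat.Induction using (<-rec)
import Data.Nat.Properties as ℕ
open import Data.Product.Base as Product
  using (Σ; _×_; _,_; ∃; ∃₂; ∃-syntax; proj₁; proj₂; uncurry)
open import Data.Sum.Base as Sum using (_⊎_; inj₁; inj₂; [_,_]′)
open import Data.Sum.Properties using (inj₁-injective; inj₂-injective)
open import Data.Vec.Base using (Vec; []; _∷_; lookup; tabulate; toList; fromList)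
open import Data.Vec.Properties using (lookup∘tabulate; toList∘fromList; length-toList)
open import Function.Base using (_∘_; id)
open import Function.Definitions using (Injective)
open import Relation.Binary.Definitions using (DecidableEquality; tri<; tri≈; tri>)
open import Relation.Binary.PropositionalEquality
  using (_≡_; _≢_; refl; sym; trans; cong; cong₂; subst; subst₂)
open import Relation.Nullary.Decidable
  using (Dec; yes; no; map′; _×-dec_; _⊎-dec_; _→-dec_; ¬?; recompute; decidable-stable)
open import Relation.Nullary.Negation using (¬_; contradiction)
open import Relation.Unary using (Decidable)

-- Minimal witnesses and search over finite types.

private
  variable
    k n : ℕ

-- `Satₘ` asks for an actual minimum. Constructively it is reached by descent: a bounded search
-- either lowers the witness or certifies that nothing smaller works.
least : {P : ℕ → Set} → Decidable P → ∀ m → P m → ∃[ k ] IsMinimum P k × k ≤ m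
least {P} P? = <-rec _ step
  where
  step : ∀ m → (∀ {j} → j ℕ.< m → P j → ∃[ k ] IsMinimum P k × k ≤ j) →
         P m → ∃[ k ] IsMinimum P k × k ≤ m
  step m rec pm with ℕ.anyUpTo? P? m
  ... | no ¬smaller =
    m , (pm , λ j pj → ℕ.≮⇒≥ λ j<m → ¬smaller (j , j<m , pj)) , ℕ.≤-refl
  ... | yes (j , j<m , pj) =
    Product.map₂ (Product.map₂ λ k≤j → ℕ.≤-trans k≤j (ℕ.<⇒≤ j<m)) (rec j<m pj)

Complete : {A : Set} → List A → Set
Complete xs = ∀ x → x ∈ xs

∃-dec : {A : Set} {xs : List A} → Complete xs →
        {P : A → Set} → Decidable P → Dec (∃ P)
∃-dec {xs = xs} complete P? =
  map′ (Product.map₂ proj₂ ∘ find) (λ (x , px) → lose (complete x) px) (Any.any? P? xs)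

∀-dec : {A : Set} {xs : List A} → Complete xs →
        {P : A → Set} → Decidable P → Dec (∀ x → P x)
∀-dec {xs = xs} complete P? =
  map′ (λ ps x → All.lookup ps (complete x)) (λ p → All.universal p xs) (All.all? P? xs)

-- Serves to enumerate both vertex maps, stored as their tables of values, and edge lists of a given
-- length.
vecs : {A : Set} → List A → ∀ k → List (Vec A k)
vecs xs zero    = [] ∷ []
vecs xs (suc k) = cartesianProductWith _∷_ xs (vecs xs k)

vecs-complete : {A : Set} {xs : List A} → Complete xs → Complete (vecs xs k)
vecs-complete complete []       = here refl
vecs-complete complete (x ∷ v)  =
  ∈-cartesianProductWith⁺ _∷_ (complete x) (vecs-complete complete v)

-- Equality and enumeration of edges.

edge-≡ : {e e′ : Edge n} → lo e ≡ lo e′ → hi e ≡ hi e′ → e ≡ e′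
edge-≡ refl refl = refl

infix 4 _≟ᴱ_

_≟ᴱ_ : DecidableEquality (Edge n)
e ≟ᴱ e′ = map′ (uncurry edge-≡) (λ { refl → refl , refl })
               (lo e ≟ lo e′ ×-dec hi e ≟ hi e′)

lo<hi′ : (e : Edge n) → lo e < hi e
lo<hi′ (edge u v u<v) = recompute (u <? v) u<v

lo≢hi : (e : Edge n) → lo e ≢ hi e
lo≢hi e = <⇒≢ (lo<hi′ e)

asEdge : Fin n × Fin n → Maybe (Edge n)
asEdge (u , v) with u <? v
... | yes u<v = just (edge u v u<v)
... | no  _   = nothing

asEdge-ends : (e : Edge n) → Maybe.Any (e ≡_) (asEdge (lo e , hi e))
asEdge-ends e with lo e <? hi e
... | yes _    = Maybe.just refl
... | no lo≮hi = contradiction (lo<hi′ e) lo≮hi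

∈-mapMaybe-asEdge : ∀ {e : Edge n} {ps} → (lo e , hi e) ∈ ps → e ∈ mapMaybe asEdge ps
∈-mapMaybe-asEdge {e = e} {ps} e∈ps =
  Anyₚ.mapMaybe⁺ asEdge ps (Anyₚ.map⁺ (Any.map (λ { refl → asEdge-ends e }) e∈ps))

allEdges : ∀ n → List (Edge n)
allEdges n = mapMaybe asEdge (cartesianProduct (allFin n) (allFin n))

allEdges-complete : Complete (allEdges n)
allEdges-complete e =
  ∈-mapMaybe-asEdge (∈-cartesianProduct⁺ (∈-allFin (lo e)) (∈-allFin (hi e)))

-- Deciding containment and saturation.

MapsTo? : (f : Fin k → Fin n) (e : Edge k) (e′ : Edge n) → Dec (MapsTo f e e′)
MapsTo? f e e′ = (f (lo e) ≟ lo e′ ×-dec f (hi e) ≟ hi e′)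
           ⊎-dec (f (lo e) ≟ hi e′ ×-dec f (hi e) ≟ lo e′)

-- A map agrees with the lookup in its own table only pointwise, so a copy must be transported along
-- pointwise equality.
MapsTo-cong : {f g : Fin k → Fin n} → (∀ i → f i ≡ g i) →
              ∀ {e e′} → MapsTo f e e′ → MapsTo g e e′
MapsTo-cong f≗g {e} = Sum.map step step
  where
  step : ∀ {u v} → _ ≡ u × _ ≡ v → _ ≡ u × _ ≡ v
  step = Product.map (trans (sym (f≗g (lo e)))) (trans (sym (f≗g (hi e))))

injective? : (f : Fin k → Fin n) → Dec (Injective _≡_ _≡_ f)
injective? f = map′ (λ inj {i} {j} → inj i j) (λ inj i j → inj)
                    (all? λ i → all? λ j → (f i ≟ f j) →-dec (i ≟ j))

contains? : (H : EdgeOrderedGraph n) (G : EdgeOrderedGraph k) → Dec (Contains H G)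
contains? {n} {k} H G =
  map′ (λ (v , c) → lookup v , c)
       (λ (f , inj , s) → let f≗v i = sym (lookup∘tabulate f i) in
          tabulate f ,
          (λ {i} {j} eq → inj (trans (f≗v i) (trans eq (sym (f≗v j))))) ,
          Sublist.map (λ {e} {e′} → MapsTo-cong f≗v {e} {e′}) s)
       (∃-dec (vecs-complete {k = k} ∈-allFin) λ v →
          injective? (lookup v) ×-dec
          Sublistₚ.sublist? (MapsTo? (lookup v)) (edges G) (edges H))

infix 4 _∈ᴱ?_

_∈ᴱ?_ : (e : Edge n) (es : List (Edge n)) → Dec (e ∈ es)
_∈ᴱ?_ = DecMembership._∈?_ _≟ᴱ_

saturated? : (H : EdgeOrderedGraph n) (G : EdgeOrderedGraph k) → Dec (IsSaturated H G)
saturated? H G =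
  map′ (λ (¬c , sat) → record { free = ¬c ; saturate = sat })
       (λ s → IsSaturated.free s , IsSaturated.saturate s)
       (¬? (contains? H G) ×-dec ∀-dec allEdges-complete saturatedAt?)
  where
  saturatedAt? : ∀ e → Dec (∀ e∉H → Contains (addFirst e H e∉H) G)
  saturatedAt? e with e ∈ᴱ? edges H
  ... | yes e∈H = yes λ e∉H → contradiction e∈H e∉H
  -- `Contains` reads only the edge list, so one proof of `e ∉ edges H` settles the question for all
  -- of them.
  ... | no  e∉H = map′ (λ c _ → c) (λ c → c e∉H) (contains? (addFirst e H e∉H) G)

hasSaturatedOfSize? : (G : EdgeOrderedGraph k) →
                      Decidable (λ m → ∃[ H ] IsSaturated {n} H G × size H ≡ m)
hasSaturatedOfSize? {n = n} G m =
  map′ (λ (v , u , s) → mkGraph (toList v) u , s , length-toList v)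
       from
       (∃-dec (vecs-complete {k = m} allEdges-complete) test)
  where
  Test : Vec (Edge n) m → Set
  Test v = Σ (Unique (toList v)) λ u → IsSaturated (mkGraph (toList v) u) G

  from : ∃[ H ] IsSaturated {n} H G × size H ≡ m → ∃ Test
  from (mkGraph es u , s , refl) =
    fromList es ,
    subst (λ es → Σ (Unique es) λ u → IsSaturated (mkGraph es u) G)
          (sym (toList∘fromList es)) (u , s)

  test : Decidable Test
  test v with DecUnique.unique? _≟ᴱ_ (toList v)
  ... | no ¬u = no (¬u ∘ proj₁)
  ... | yes u = map′ (u ,_)
    -- The two graphs may differ in their proofs of uniqueness; the fields of `IsSaturated` have the
    -- same types for both.
    (λ (_ , s) → record { free = IsSaturated.free s ; saturate = IsSaturated.saturate s })
    (saturated? (mkGraph (toList v) u) G)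

-- Reduces the theorem to exhibiting one saturated graph of bounded size.
satₘ≤ : ∀ {H : EdgeOrderedGraph n} {G : EdgeOrderedGraph k} → IsSaturated H G →
        ∃[ m ] Satₘ n G m × m ≤ size H
satₘ≤ {H = H} {G} s = least (hasSaturatedOfSize? G) (size H) (H , s , refl)

-- Greedy saturation.

Contains-mono : {H H′ : EdgeOrderedGraph n} {G : EdgeOrderedGraph k} →
                edges H ⊆ edges H′ → Contains H G → Contains H′ G
Contains-mono H⊆H′ (f , inj , s) =
  f , inj , Sublistₚ.trans (λ { p refl → p }) s H⊆H′

-- One pass suffices: each edge of `L` is put in front unless that completes a copy, and a rejected
-- edge would still complete one in any larger graph.
saturateOn : (G : EdgeOrderedGraph k) (L : List (Edge n)) (H : EdgeOrderedGraph n) →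
  ¬ Contains H G →
  ∃[ H′ ] ¬ Contains H′ G × edges H ⊆ edges H′ × size H′ ≤ length L + size H ×
          (∀ {e} → e ∈ L → ∀ e∉H′ → Contains (addFirst e H′ e∉H′) G)
saturateOn G []      H free = H , free , ⊆-refl , ℕ.≤-refl , λ ()
saturateOn G (e ∷ L) H free with e ∈ᴱ? edges H
... | yes e∈H =
  let H′ , free′ , H⊆H′ , bound , sat = saturateOn G L H free in
  H′ , free′ , H⊆H′ , ℕ.m≤n⇒m≤1+n bound , λ where
    (here refl) e∉H′ → contradiction (lookup-⊆ H⊆H′ e∈H) e∉H′
    (there e∈L) e∉H′ → sat e∈L e∉H′
... | no e∉H with contains? (addFirst e H e∉H) G
...   | yes c =
  let H′ , free′ , H⊆H′ , bound , sat = saturateOn G L H free in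
  H′ , free′ , H⊆H′ , ℕ.m≤n⇒m≤1+n bound , λ where
    (here refl) e∉H′ →
      -- Edges accepted later come between `e` and `H`, so `e` followed by `H` remains a sublist.
      Contains-mono {H = addFirst e H e∉H} {addFirst e H′ e∉H′} {G} (refl ∷ H⊆H′) c
    (there e∈L) e∉H′ → sat e∈L e∉H′
...   | no ¬c =
  let H′ , free′ , eH⊆H′ , bound , sat = saturateOn G L (addFirst e H e∉H) ¬c in
  H′ , free′ , ⊆-trans (e ∷ʳ ⊆-refl) eH⊆H′ ,
  subst (size H′ ≤_) (ℕ.+-suc (length L) (size H)) bound , λ where
    (here refl) e∉H′ → contradiction (lookup-⊆ eH⊆H′ (here refl)) e∉H′
    (there e∈L) e∉H′ → sat e∈L e∉H′

-- Endpoints of edges up to exchange.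

Joins : Fin n → Fin n → Edge n → Set
Joins u v e = (u ≡ lo e × v ≡ hi e) ⊎ (u ≡ hi e × v ≡ lo e)

Joins-endpoints : ∀ {u v u′ v′} {e : Edge n} → Joins u v e → Joins u′ v′ e →
                  (u ≡ u′ × v ≡ v′) ⊎ (u ≡ v′ × v ≡ u′)
Joins-endpoints (inj₁ (refl , refl)) (inj₁ (refl , refl)) = inj₁ (refl , refl)
Joins-endpoints (inj₁ (refl , refl)) (inj₂ (refl , refl)) = inj₂ (refl , refl)
Joins-endpoints (inj₂ (refl , refl)) (inj₁ (refl , refl)) = inj₂ (refl , refl)
Joins-endpoints (inj₂ (refl , refl)) (inj₂ (refl , refl)) = inj₁ (refl , refl)

-- Both edges store the smaller endpoint first, which rules out the exchanged case.
Joins⇒≡ : {e e′ : Edge n} → Joins (lo e) (hi e) e′ → e ≡ e′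
Joins⇒≡ (inj₁ (p , q)) = edge-≡ p q
Joins⇒≡ {e = e} {e′} (inj₂ (p , q)) =
  contradiction (lo<hi′ e′) (<-asym (subst₂ _<_ p q (lo<hi′ e)))

link : (u v : Fin n) → u ≢ v → Edge n
link u v u≢v with <-cmp u v
... | tri< u<v _ _ = edge u v u<v
... | tri≈ _ u≡v _ = contradiction u≡v u≢v
... | tri> _ _ v<u = edge v u v<u

link-MapsTo : (f : Fin k → Fin n) {i j : Fin k} (i≢j : i ≢ j) {e : Edge n} →
              MapsTo f (link i j i≢j) e → Joins (f i) (f j) e
link-MapsTo f {i} {j} i≢j m with <-cmp i j
-- For `i < j`, the `MapsTo` hypothesis unfolds to `Joins (f i) (f j) e`.
... | tri< _ _ _   = m
... | tri≈ _ i≡j _ = contradiction i≡j i≢j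
link-MapsTo f i≢j (inj₁ (p , q)) | tri> _ _ _ = inj₂ (q , p)
link-MapsTo f i≢j (inj₂ (p , q)) | tri> _ _ _ = inj₁ (q , p)

link-Joins : (u v : Fin n) (u≢v : u ≢ v) → Joins u v (link u v u≢v)
link-Joins u v u≢v = link-MapsTo id u≢v {link u v u≢v} (inj₁ (refl , refl))

-- Pigeonhole arguments and sublists.

injective⇒surjective : {f : Fin n → Fin n} → Injective _≡_ _≡_ f → ∀ y → ∃[ x ] f x ≡ y
injective⇒surjective {suc n} {f} inj y = decidable-stable (any? λ x → f x ≟ y) λ missed →
  let y≢f x = missed ∘ (x ,_) ∘ sym in
  -- Punching out a missed value would inject `Fin (suc n)` into `Fin n`.
  ℕ.1+n≰n (injective⇒≤ {f = λ x → punchOut (y≢f x)}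
             λ eq → inj (punchOut-injective (y≢f _) (y≢f _) eq))

lookup-injective : {A : Set} {xs : List A} → Unique xs → Injective _≡_ _≡_ (List.lookup xs)
lookup-injective {xs = _ ∷ _}  _        {zero}  {zero}  _  = refl
lookup-injective {xs = _ ∷ xs} (x≢ ∷ _) {zero}  {suc j} eq =
  contradiction eq (All.lookup x≢ (∈-lookup j))
lookup-injective {xs = _ ∷ xs} (x≢ ∷ _) {suc i} {zero}  eq =
  contradiction (sym eq) (All.lookup x≢ (∈-lookup i))
lookup-injective {xs = _ ∷ _}  (_ ∷ u)  {suc i} {suc j} eq = cong suc (lookup-injective u eq)

no-four-in-Fin3 : {a b c d : Fin 3} → ¬ Unique (a ∷ b ∷ c ∷ d ∷ [])
no-four-in-Fin3 u = ℕ.1+n≰n (injective⇒≤ (lookup-injective u))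

-- Since block `b` omits the hub `b`, this pins down the one hub common to the blocks `b` and `c`.
third-hub : ∀ {b c h h′ : Fin 3} → b ≢ c → h ≢ b × h ≢ c → h′ ≢ b × h′ ≢ c → h ≡ h′
third-hub {b} {c} {h} {h′} b≢c (h≢b , h≢c) (h′≢b , h′≢c) =
  decidable-stable (h ≟ h′) λ h≢h′ → no-four-in-Fin3
    ((h≢h′ ∷ h≢b ∷ h≢c ∷ []) ∷ (h′≢b ∷ h′≢c ∷ []) ∷ (b≢c ∷ []) ∷ [] ∷ [])

module _ {A B : Set} {R : A → B → Set} where

  -- If `x` is matched within `zs`, the order forces everything after it into `zs` too.
  Sublist-++⁻ : ∀ {x xs} ys {zs} → Sublist R (x ∷ xs) (ys ++ zs) →
                Any (R x) ys ⊎ Sublist R (x ∷ xs) zs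
  Sublist-++⁻ []       s         = inj₂ s
  Sublist-++⁻ (y ∷ ys) (y ∷ʳ s)  = Sum.map₁ there (Sublist-++⁻ ys s)
  Sublist-++⁻ (y ∷ ys) (r ∷ _)   = inj₁ (here r)

  Sublist-∈ : ∀ {x xs ys} → Sublist R xs ys → x ∈ xs → ∃[ y ] y ∈ ys × R x y
  Sublist-∈ s x∈xs = find (Sublist.lookup (λ { r refl → r }) s x∈xs)

-- Fixing `y` selects one pair from each row, in the order of `xs`; this is why each block inherits
-- the edge order of `K`.
row-Sublist : {A B : Set} (xs : List A) {ys : List B} {y : B} → y ∈ ys →
              Sublist (λ x p → p ≡ (x , y)) xs (cartesianProduct xs ys)
row-Sublist []       y∈ys = []
row-Sublist (x ∷ xs) y∈ys =
  Sublistₚ.++⁺ (Sublist.fromAny (Anyₚ.map⁺ (Any.map (λ { refl → refl }) y∈ys)))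
               (row-Sublist xs y∈ys)

-- Vertices of the glued graph and their coding in `Fin n`.

Vertex : ℕ → Set
Vertex r = Fin 3 ⊎ (Fin 3 × Fin r)

-- Hubs are shared between the blocks; `leaf b v` stands for the vertex `v` of `K` in block `b`
-- alone.
pattern hub h    = inj₁ h
pattern leaf b v = inj₂ (b , v)

hub-or-leaf : ∀ {r} (x : Vertex r) → (∃[ h ] x ≡ hub h) ⊎ (∃₂ λ b v → x ≡ leaf b v)
hub-or-leaf (hub h)    = inj₁ (h , refl)
hub-or-leaf (leaf b v) = inj₂ (b , v , refl)

vertices : ∀ r → List (Vertex r)
vertices r = map inj₁ (allFin 3) ++ map inj₂ (cartesianProduct (allFin 3) (allFin r))

vertices-complete : ∀ {r} → Complete (vertices r)
vertices-complete (hub h)    = Anyₚ.++⁺ˡ (∈-map⁺ inj₁ (∈-allFin h))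
vertices-complete (leaf b v) =
  Anyₚ.++⁺ʳ _ (∈-map⁺ inj₂ (∈-cartesianProduct⁺ (∈-allFin b) (∈-allFin v)))

encode : ∀ {r} → 3 + 3 * r ≤ n → Vertex r → Fin n
encode {r = r} N≤n = (λ i → inject≤ i N≤n) ∘ join 3 (3 * r) ∘ Sum.map₂ (uncurry combine)

encode-injective : ∀ {r} (N≤n : 3 + 3 * r ≤ n) → Injective _≡_ _≡_ (encode {r = r} N≤n)
encode-injective {n} {r} N≤n {x} {y} eq = lemma x y
  (trans (sym (splitAt-join 3 (3 * r) (Sum.map₂ (uncurry combine) x)))
         (trans (cong (splitAt 3) (inject≤-injective N≤n N≤n _ _ eq))
                (splitAt-join 3 (3 * r) (Sum.map₂ (uncurry combine) y))))
  where
  lemma : ∀ x y → Sum.map₂ (uncurry combine) x ≡ Sum.map₂ (uncurry combine) y → x ≡ y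
  lemma (hub h)    (hub _)    refl = refl
  lemma (leaf b v) (leaf c w) eq   = cong inj₂ (uncurry (cong₂ _,_)
    (combine-injective b v c w (inj₂-injective eq)))

-- Three copies of `K` glued along the hub triangle.

module Blocks {s n : ℕ}
  (k₀ : Edge (2 + s)) (ks : List (Edge (2 + s))) (distinct-K : Unique (k₀ ∷ ks))
  (code : Vertex (2 + s) → Fin n) (code-injective : Injective _≡_ _≡_ code)
  where

  r : ℕ
  r = 2 + s

  K : EdgeOrderedGraph r
  K = mkGraph (k₀ ∷ ks) distinct-K

  -- Indexing the ends by `Fin 2` lets `punchIn b` send them to the two hubs other than `b`.
  end : Fin 2 → Fin r
  end zero    = lo k₀
  end (suc _) = hi k₀

  -- Abstract, so that unification can read v off role v.
  abstract
    role : Fin r → Fin 2 ⊎ Fin r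
    role v with v ≟ lo k₀ | v ≟ hi k₀
    ... | yes _ | _     = inj₁ zero
    ... | no  _ | yes _ = inj₁ (suc zero)
    ... | no  _ | no  _ = inj₂ v

    unrole-role : ∀ v → [ end , id ]′ (role v) ≡ v
    unrole-role v with v ≟ lo k₀ | v ≟ hi k₀
    ... | yes p | _     = sym p
    ... | no  _ | yes p = sym p
    ... | no  _ | no  _ = refl

    role-end : ∀ t → role (end t) ≡ inj₁ t
    role-end zero with lo k₀ ≟ lo k₀
    ... | yes _  = refl
    ... | no  ≢  = contradiction refl ≢
    role-end (suc zero) with hi k₀ ≟ lo k₀ | hi k₀ ≟ hi k₀
    ... | yes p | _     = contradiction (sym p) (lo≢hi k₀)
    ... | no  _ | yes _ = refl
    ... | no  _ | no  ≢ = contradiction refl ≢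

  -- In block b the first edge of K becomes the hub edge that omits the hub b.
  place : Fin 3 → Fin 2 ⊎ Fin r → Vertex r
  place b = Sum.map (punchIn b) (b ,_)

  place-injective : ∀ b {x y} → place b x ≡ place b y → x ≡ y
  place-injective b {inj₁ x} {inj₁ y} eq =
    cong inj₁ (punchIn-injective b x y (inj₁-injective eq))
  place-injective b {inj₂ _} {inj₂ _} refl = refl

  place-leaf : ∀ {b c v} x → place b x ≡ leaf c v → b ≡ c
  place-leaf (inj₂ _) refl = refl

  -- A leaf records its block, so a common vertex of two blocks is a hub, and each block omits its
  -- own hub.
  place-≢ : ∀ {b c} x y → b ≢ c → place b x ≡ place c y →
            ∃[ h ] place b x ≡ hub h × h ≢ b × h ≢ c
  place-≢ {b} {c} (inj₁ x) (inj₁ y) b≢c eq =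
    punchIn b x , refl , punchInᵢ≢i b x ,
    λ h≡c → punchInᵢ≢i c y (trans (sym (inj₁-injective eq)) h≡c)
  place-≢ (inj₂ _) (inj₂ _) b≢c refl = contradiction refl b≢c

  embed : Fin 3 → Fin r → Fin n
  embed b = code ∘ place b ∘ role

  embed-injective : ∀ b → Injective _≡_ _≡_ (embed b)
  embed-injective b {x} {y} eq =
    trans (sym (unrole-role x))
          (trans (cong [ end , id ]′ (place-injective b {role x} {role y} (code-injective eq)))
                 (unrole-role y))

  embed-end : ∀ b t → embed b (end t) ≡ code (hub (punchIn b t))
  embed-end b t = cong (code ∘ place b) (role-end t)

  embed-hub : ∀ b v {h} → embed b v ≡ code (hub h) → ∃[ t ] v ≡ end t
  embed-hub b v eq with role v | unrole-role v | code-injective eq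
  ... | inj₁ t | p | _  = t , sym p
  ... | inj₂ _ | _ | ()

  -- Later arguments see an image only through `image-Joins`, so it never matters which endpoint is
  -- the smaller.
  abstract
    image : Edge r × Fin 3 → Edge n
    image (e , b) = link (embed b (lo e)) (embed b (hi e)) (lo≢hi e ∘ embed-injective b)

    image-Joins : ∀ e b → Joins (embed b (lo e)) (embed b (hi e)) (image (e , b))
    image-Joins e b = link-Joins _ _ _

  shared-hub : ∀ {b c} v w → b ≢ c → embed b v ≡ embed c w →
               ∃[ h ] embed b v ≡ code (hub h) × h ≢ b × h ≢ c
  shared-hub v w b≢c eq =
    Product.map₂ (Product.map₁ (cong code)) (place-≢ (role v) (role w) b≢c (code-injective eq))

  -- Distinct blocks share a single vertex, hence no edge.
  image-block : ∀ e e′ {b c} → image (e , b) ≡ image (e′ , c) → b ≡ c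
  image-block e e′ {b} {c} eq = decidable-stable (b ≟ c) λ b≢c →
    let ends = Joins-endpoints {e = image (e , b)} (image-Joins e b)
                 (subst (Joins _ _) (sym eq) (image-Joins e′ c))
        h  , p  , q  = [ (λ (p , _) → shared-hub (lo e) (lo e′) b≢c p)
                       , (λ (p , _) → shared-hub (lo e) (hi e′) b≢c p) ]′ ends
        h′ , p′ , q′ = [ (λ (_ , p) → shared-hub (hi e) (hi e′) b≢c p)
                       , (λ (_ , p) → shared-hub (hi e) (lo e′) b≢c p) ]′ ends
    in lo≢hi e (embed-injective b
         (trans p (trans (cong (code ∘ inj₁) (third-hub b≢c q q′)) (sym p′))))

  image-edge : ∀ e e′ {b} → image (e , b) ≡ image (e′ , b) → e ≡ e′
  image-edge e e′ {b} eq = Joins⇒≡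
    (Sum.map (Product.map inj inj) (Product.map inj inj)
      (Joins-endpoints {e = image (e , b)} (image-Joins e b)
        (subst (Joins _ _) (sym eq) (image-Joins e′ b))))
    where
    inj : ∀ {x y} → embed b x ≡ embed b y → x ≡ y
    inj = embed-injective b

  image-injective : ∀ {p q} → image p ≡ image q → p ≡ q
  image-injective {e , b} {e′ , c} eq with refl ← image-block e e′ {b} {c} eq =
    cong (_, b) (image-edge e e′ eq)

  -- Grouped by edge, then by block: the hub edges, being the images of k₀, come first in H₀.
  blocks : List (Edge r) → List (Edge r × Fin 3)
  blocks es = cartesianProduct es (allFin 3)

  H₀ : EdgeOrderedGraph n
  H₀ = mkGraph (map image (blocks (k₀ ∷ ks)))
         (Uniqueₚ.map⁺ image-injective
           (Uniqueₚ.cartesianProduct⁺ distinct-K (Uniqueₚ.allFin⁺ 3)))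

  size-H₀ : size H₀ ≡ length (blocks (k₀ ∷ ks))
  size-H₀ = length-map image (blocks (k₀ ∷ ks))

  copy : ∀ b → Sublist (MapsTo (embed b)) (k₀ ∷ ks) (edges H₀)
  -- `Sublistₚ.map⁺` maps both lists; `map-id` removes the identity on the left.
  copy b = subst (λ es → Sublist (MapsTo (embed b)) es (edges H₀)) (map-id (k₀ ∷ ks))
    (Sublistₚ.map⁺ id image
      (Sublist.map {R = λ e p → p ≡ (e , b)} (λ { {e} refl → image-Joins e b })
        (row-Sublist (k₀ ∷ ks) (∈-allFin b))))

  -- Block `h` omits the hub `h`, and a leaf of block `c` is missed by any other block, such as
  -- `punchIn c zero`.
  avoiding-block : ∀ x → ∃[ b ] (∀ v → embed b v ≢ code x)
  avoiding-block (hub h)    = h , λ v eq → avoid (role v) (code-injective eq)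
    where
    avoid : ∀ x → place h x ≢ hub h
    avoid (inj₁ t) eq = punchInᵢ≢i h t (inj₁-injective eq)
  avoiding-block (leaf c w) = punchIn c zero ,
    λ v eq → punchInᵢ≢i c zero (place-leaf (role v) (code-injective eq))

  -- The glued graph contains no `e₀+ K`.

  module _ (complete : IsComplete K) where

    -- The list `ps` is left general: cliques are studied both in all of `H₀` and in its part after
    -- the triangle.
    module _ {f : Fin r → Fin n} {ps : List (Edge r × Fin 3)}
             (s : Sublist (MapsTo f) (k₀ ∷ ks) (map image ps)) where

      adjacent : ∀ {i j} → i ≢ j → ∃₂ λ e b → (e , b) ∈ ps ×
                 ((f i ≡ embed b (lo e) × f j ≡ embed b (hi e)) ⊎
                  (f i ≡ embed b (hi e) × f j ≡ embed b (lo e)))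
      adjacent i≢j =
        let e′ , e′∈ , m = Sublist-∈ s (complete (link _ _ i≢j))
            (e , b) , p∈ , eq = ∈-map⁻ image e′∈
        in e , b , p∈ , Joins-endpoints {e = e′} (link-MapsTo f i≢j {e′} m)
                          (subst (Joins _ _) (sym eq) (image-Joins e b))

      same-block : ∀ {i j} → i ≢ j → ∃[ b ] ∃₂ λ v w → f i ≡ embed b v × f j ≡ embed b w
      same-block i≢j with adjacent i≢j
      ... | e , b , _ , inj₁ ends = b , _ , _ , ends
      ... | e , b , _ , inj₂ ends = b , _ , _ , ends

      module _ (f-injective : Injective _≡_ _≡_ f) where

        TwoHubs : Set
        TwoHubs = ∃₂ λ i j → i ≢ j × ∃₂ λ h h′ → f i ≡ code (hub h) × f j ≡ code (hub h′)

        -- A leaf is adjacent only to its own block, so a clique through it fills that block.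
        leaf⇒two-hubs : ∀ {i b v w} → f i ≡ embed b v → place b (role v) ≡ leaf b w → TwoHubs
        leaf⇒two-hubs {i} {b} {v} fi≡ at-leaf =
          -- In every block the ends of `k₀` sit on hubs, so the two vertices mapped there are the
          -- ones sought.
          let i₀ , p₀ = onto (end zero)
              i₁ , p₁ = onto (end (suc zero))
          in i₀ , i₁ ,
             (λ i₀≡i₁ → lo≢hi k₀ (trans (sym p₀) (trans (cong σ i₀≡i₁) p₁))) ,
             _ , _ ,
             trans (in-block i₀) (trans (cong (embed b) p₀) (embed-end b zero)) ,
             trans (in-block i₁) (trans (cong (embed b) p₁) (embed-end b (suc zero)))
          where
          preimage : ∀ j → ∃[ w ] f j ≡ embed b w
          preimage j with i ≟ j
          ... | yes refl = v , fi≡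
          ... | no i≢j with c , v′ , w , p , q ← same-block i≢j
                       with refl ← place-leaf {c} {b} (role v′)
                              (trans (code-injective (trans (sym p) fi≡)) at-leaf) = w , q

          σ : Fin r → Fin r
          σ = proj₁ ∘ preimage

          in-block : ∀ j → f j ≡ embed b (σ j)
          in-block = proj₂ ∘ preimage

          onto : ∀ y → ∃[ x ] σ x ≡ y
          onto = injective⇒surjective λ {x} {y} eq → f-injective
            (trans (in-block x) (trans (cong (embed b) eq) (sym (in-block y))))

        -- Look at the first two vertices, available as `r` is at least 2: either both land on hubs,
        -- or one lands on a leaf and its block is filled.
        two-hubs : TwoHubs
        two-hubs with b , v , w , p , q ← same-block {zero} {suc zero} (λ ())
                 with hub-or-leaf (place b (role v)) | hub-or-leaf (place b (role w))
        ... | inj₁ (h , at-v) | inj₁ (h′ , at-w) =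
          zero , suc zero , (λ ()) , h , h′ , trans p (cong code at-v) , trans q (cong code at-w)
        ... | inj₂ (c , _ , at-v) | _
            with refl ← place-leaf (role v) at-v = leaf⇒two-hubs p at-v
        ... | inj₁ _ | inj₂ (c , _ , at-w)
            with refl ← place-leaf (role w) at-w = leaf⇒two-hubs q at-w

    ends⇒k₀ : ∀ {e : Edge r} t t′ → lo e ≡ end t → hi e ≡ end t′ → e ≡ k₀
    ends⇒k₀ {e} zero       zero       p q = contradiction (trans p (sym q)) (lo≢hi e)
    ends⇒k₀     zero       (suc zero) p q = Joins⇒≡ (inj₁ (p , q))
    ends⇒k₀     (suc zero) zero       p q = Joins⇒≡ (inj₂ (p , q))
    ends⇒k₀ {e} (suc zero) (suc zero) p q = contradiction (trans p (sym q)) (lo≢hi e)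

    -- Within a block, only the ends of `k₀` are sent to hubs.
    hub-edge : ∀ {e b h h′} → embed b (lo e) ≡ code (hub h) → embed b (hi e) ≡ code (hub h′) →
               e ≡ k₀
    hub-edge {e} {b} p q =
      let t , p′ = embed-hub b (lo e) p
          t′ , q′ = embed-hub b (hi e) q
      in ends⇒k₀ t t′ p′ q′

    -- Expresses that two sides of a triangle meet: disjoint sides would need four hubs.
    four-hubs : {f : Fin (2 + r) → Fin n} → Injective _≡_ _≡_ f →
      ∀ {i j} → i ≢ j → ∀ {a b c d} →
      f zero ≡ code (hub a) → f (suc zero) ≡ code (hub b) →
      f (suc (suc i)) ≡ code (hub c) → ¬ f (suc (suc j)) ≡ code (hub d)
    four-hubs {f} inj {i} {j} i≢j {a} {b} {c} {d} pa pb pc pd = no-four-in-Fin3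
      ((apart pa pb (λ ()) ∷ apart pa pc (λ ()) ∷ apart pa pd (λ ()) ∷ []) ∷
       (apart pb pc (λ ()) ∷ apart pb pd (λ ()) ∷ []) ∷
       (apart pc pd (λ { refl → i≢j refl }) ∷ []) ∷ [] ∷ [])
      where
      apart : ∀ {x y g h} → f x ≡ code (hub g) → f y ≡ code (hub h) → x ≢ y → g ≢ h
      apart p q x≢y refl = x≢y (inj (trans p (sym q)))

    first-edge-block : {P : Edge n → Set} → Any P (map image (blocks (k₀ ∷ []))) →
                       ∃[ b ] P (image (k₀ , b))
    first-edge-block (here m)                 = _ , m
    first-edge-block (there (here m))         = _ , m
    first-edge-block (there (there (here m))) = _ , m

    e₀-not-on-first-edge : {f : Fin (2 + r) → Fin n} → Injective _≡_ _≡_ f →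
      ∀ {i j} → i ≢ j → ∀ {h h′} →
      f (suc (suc i)) ≡ code (hub h) → f (suc (suc j)) ≡ code (hub h′) →
      ¬ Any (MapsTo f e₀) (map image (blocks (k₀ ∷ [])))
    e₀-not-on-first-edge {f} inj i≢j p q e₀↦ with first-edge-block e₀↦
    ... | b , m with Joins-endpoints {e = image (k₀ , b)} m (image-Joins k₀ b)
    ... | inj₁ (x , y) = four-hubs {f} inj i≢j
            (trans x (embed-end b zero)) (trans y (embed-end b (suc zero))) p q
    ... | inj₂ (x , y) = four-hubs {f} inj i≢j
            (trans x (embed-end b (suc zero))) (trans y (embed-end b zero)) p q

    k₀∉blocks : ∀ {e b} → (e , b) ∈ blocks ks → e ≢ k₀
    k₀∉blocks ∈ps e≡k₀ = All.lookup (AllPairs.head distinct-K)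
      (proj₁ (∈-cartesianProduct⁻ ks (allFin 3) ∈ps)) (sym e≡k₀)

    -- The clique edge between the two hubs must come from `k₀`, which is absent after the triangle.
    hubs-need-k₀ : {g : Fin r → Fin n} → ∀ {i j} → i ≢ j → ∀ {h h′} →
      g i ≡ code (hub h) → g j ≡ code (hub h′) →
      ¬ Sublist (MapsTo g) (k₀ ∷ ks) (map image (blocks ks))
    hubs-need-k₀ {g} i≢j p q s with adjacent {g} {blocks ks} s i≢j
    ... | e , b , ∈ps , inj₁ (x , y) =
      k₀∉blocks ∈ps (hub-edge {e} {b} (trans (sym x) p) (trans (sym y) q))
    ... | e , b , ∈ps , inj₂ (x , y) =
      k₀∉blocks ∈ps (hub-edge {e} {b} (trans (sym y) q) (trans (sym x) p))

    H₀-free : ¬ Contains H₀ (e₀+ K)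
    H₀-free (f , inj , s) =
      let i , j , i≢j , _ , _ , p , q =
            two-hubs {g} {blocks (k₀ ∷ ks)} (clique (Sublistₚ.∷ˡ⁻ s)) g-injective
      in [ e₀-not-on-first-edge {f} inj i≢j p q
         , hubs-need-k₀ {g} i≢j p q ∘ clique ∘ Sublistₚ.∷ˡ⁻ ]′
         -- By computation `edges H₀` is the triangle followed by the images of `blocks ks`. Either
         -- `e₀` lands on the triangle, or the whole copy lies after it.
         (Sublist-++⁻ (map image (blocks (k₀ ∷ []))) s)
      where
      g : Fin r → Fin n
      g v = f (suc (suc v))

      g-injective : Injective _≡_ _≡_ g
      g-injective eq = Fin.suc-injective (Fin.suc-injective (inj eq))

      clique : ∀ {es} → Sublist (MapsTo f) (map shift (k₀ ∷ ks)) es →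
               Sublist (MapsTo g) (k₀ ∷ ks) es
      clique {es} = Sublistₚ.map⁻ shift id ∘ subst (Sublist _ _) (sym (map-id es))

  -- Saturating the glued graph on `n` vertices.

  extend-copy : ∀ {e b} H → edges H₀ ⊆ edges H → (e∉H : e ∉ edges H) →
    (∀ v → embed b v ≢ lo e) → (∀ v → embed b v ≢ hi e) →
    Contains (addFirst e H e∉H) (e₀+ K)
  -- The new edge, first in the order, plays `e₀`; block `b`, disjoint from it, plays `K`.
  extend-copy {e} {b} H H₀⊆H e∉H lo∉b hi∉b = f , f-injective , inj₁ (refl , refl) ∷
    subst (Sublist _ _) (map-id (edges H))
      (Sublistₚ.map⁺ shift id (Sublistₚ.trans (λ { m refl → m }) (copy b) H₀⊆H))
    where
    f : Fin (2 + r) → Fin n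
    f zero          = lo e
    f (suc zero)    = hi e
    f (suc (suc v)) = embed b v

    f-injective : Injective _≡_ _≡_ f
    f-injective {zero}        {zero}        eq = refl
    f-injective {zero}        {suc zero}    eq = contradiction eq (lo≢hi e)
    f-injective {zero}        {suc (suc _)} eq = contradiction (sym eq) (lo∉b _)
    f-injective {suc zero}    {zero}        eq = contradiction (sym eq) (lo≢hi e)
    f-injective {suc zero}    {suc zero}    eq = refl
    f-injective {suc zero}    {suc (suc _)} eq = contradiction (sym eq) (hi∉b _)
    f-injective {suc (suc _)} {zero}        eq = contradiction eq (lo∉b _)
    f-injective {suc (suc _)} {suc zero}    eq = contradiction eq (hi∉b _)
    f-injective {suc (suc v)} {suc (suc w)} eq = cong (λ v → suc (suc v)) (embed-injective b eq)

  -- Pairs are listed before coding, so their number depends on `r` and not on `n`.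
  pairs : List (Vertex r × Vertex r)
  pairs = cartesianProduct (vertices r) (vertices r)

  innerPairs : List (Fin n × Fin n)
  innerPairs = map (Product.map code code) pairs

  innerEdges : List (Edge n)
  innerEdges = mapMaybe asEdge innerPairs

  coded? : ∀ u → Dec (∃[ x ] code x ≡ u)
  coded? u = ∃-dec vertices-complete λ x → code x ≟ u

  outer-avoided : ∀ {u} → ¬ (∃[ x ] code x ≡ u) → ∀ b v → embed b v ≢ u
  outer-avoided ¬coded b v eq = ¬coded (_ , eq)

  block-avoiding : ∀ u → ∃[ b ] (∀ v → embed b v ≢ u)
  block-avoiding u with coded? u
  ... | yes (x , refl) = avoiding-block x
  ... | no ¬coded      = zero , outer-avoided ¬coded zero

  ∈innerEdges : ∀ {e : Edge n} x y → code x ≡ lo e → code y ≡ hi e → e ∈ innerEdges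
  ∈innerEdges x y p q = ∈-mapMaybe-asEdge {ps = innerPairs}
    (subst₂ (λ u v → (u , v) ∈ innerPairs) p q
      (∈-map⁺ (Product.map code code)
        (∈-cartesianProduct⁺ (vertices-complete x) (vertices-complete y))))

  -- The greedy pass settles edges with both ends coded. An uncoded end lies in no block, so for any
  -- other edge a block avoiding the remaining end completes a copy.
  saturated : IsComplete K →
    ∃[ H ] IsSaturated {n} H (e₀+ K) × size H ≤ length pairs + length (blocks (k₀ ∷ ks))
  saturated complete
    with H , free , H₀⊆H , bound , inner ← saturateOn (e₀+ K) innerEdges H₀ (H₀-free complete)
    = H , record { free = free ; saturate = saturate } , (begin
        size H                                    ≤⟨ bound ⟩
        length innerEdges + size H₀               ≤⟨ ℕ.+-monoˡ-≤ (size H₀)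
                                                       (length-mapMaybe asEdge innerPairs) ⟩
        length innerPairs + size H₀               ≡⟨ cong₂ _+_ (length-map _ pairs) size-H₀ ⟩
        length pairs + length (blocks (k₀ ∷ ks))  ∎)
    where
    open ℕ.≤-Reasoning

    saturate : ∀ e e∉H → Contains (addFirst e H e∉H) (e₀+ K)
    saturate e e∉H with coded? (lo e) | coded? (hi e)
    ... | yes (x , p) | yes (y , q) = inner (∈innerEdges x y p q) e∉H
    ... | no ¬coded   | _           = let b , hi∉b = block-avoiding (hi e) in
      extend-copy H H₀⊆H e∉H (outer-avoided ¬coded b) hi∉b
    ... | yes _       | no ¬coded   = let b , lo∉b = block-avoiding (lo e) in
      extend-copy H H₀⊆H e∉H lo∉b (outer-avoided ¬coded b)

corollary44 : ∀ (r : ℕ) → 2 ≤ r →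
    ∀ (K : EdgeOrderedGraph r) → IsComplete K →
    ∃[ C ] ∃[ N ] (∀ n → N ≤ n → ∃[ m ] (Satₘ n (e₀+ K) m × m ≤ C))
corollary44 (suc (suc s)) (s≤s (s≤s _)) (mkGraph [] _) complete =
  contradiction (complete (edge zero (suc zero) (s≤s z≤n))) λ ()
corollary44 r@(suc (suc s)) (s≤s (s≤s _)) K@(mkGraph (k₀ ∷ ks) distinct-K) complete =
  -- At most one greedy edge per pair of glued vertices, plus three images of each edge of `K`:
  -- neither term involves `n`.
  length (cartesianProduct (vertices r) (vertices r)) +
  length (cartesianProduct (k₀ ∷ ks) (allFin 3)) ,
  -- Room for three hubs and `r` leaves per block.
  3 + 3 * r ,
  λ n N≤n →
    let H , sat , bound = Blocks.saturated k₀ ks distinct-K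
                            (encode N≤n) (encode-injective {r = r} N≤n) complete
        m , min , m≤size = satₘ≤ sat
    in m , min , ℕ.≤-trans m≤size bound
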